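{- Let $n$ be a positive integer, $g=3n+1$, and let $G$ be a pure $(2n)$-sparse gapset of genus $g$ with depth $q$. Then $G$ is symmetric if and only if $q=4$.
   Context: A gapset is a finite set $G\subset\mathbb{N}=\{1,2,\dots\}$ such that whenever $z\in G$ and $z=x+y$ with $x,y\in\mathbb{N}$, then $x\in G$ or $y\in G$; its genus is $g=\#G$. Write $G=\{\ell_1<\dots<\ell_g\}$. Multiplicity $m(G)=\min\{s\in\mathbb{N}:s\notin G\}$; conductor $c(G)=\min\{s\in\mathbb{N}: s+t\notin G\ \forall t\in\mathbb{N}_0\}$; Frobenius number $F(G)=c(G)-1=\ell_g$; depth $q(G)=\lceil c(G)/m(G)\rceil$. $G$ is symmetric if $F(G)=2g-1$. $G$ is pure $\kappa$-sparse if $\ell_{i+1}-\ell_i\le\kappa$ for all $i$ with equality for some $i$. -}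

module Defs where

open import Data.Fin.Base using (Fin; toℕ)
open import Data.List.Base using (List; length; lookup)
open import Data.List.Extrema.Nat using (max; xs≤max)
open import Data.List.Membership.Propositional using (_∈_; _∉_)
import Data.List.Membership.DecPropositional as DecMembership
open import Data.List.Relation.Unary.All as All using (All)
open import Data.List.Relation.Unary.Linked using (Linked)
open import Data.Nat.Base
open import Data.Nat.DivMod using (_/_)
open import Data.Nat.Properties
open import Data.Product.Base using (∃; ∃₂; _×_; _,_; proj₁; proj₂)
open import Data.Sum.Base using (_⊎_)
open import Relation.Binary.PropositionalEquality
open import Relation.Nullary.Decidable using (yes; no; map′; ¬?; _×-dec_)
open import Relation.Nullary.Negation using (contradiction)
open import Relation.Unary using (Pred; Decidable)
open import Level using (0ℓ)

open DecMembership _≟_ using (_∈?_)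

-- A finite set of positive integers is given by its strictly increasing
-- list of elements ℓ₁ < ⋯ < ℓ_g; this representation is unique.
record Gapset : Set where
  field
    elements   : List ℕ
    increasing : Linked _<_ elements
    positive   : All (1 ≤_) elements
    splits     : ∀ {x y} → 1 ≤ x → 1 ≤ y →
                 x + y ∈ elements → x ∈ elements ⊎ y ∈ elements

  genus : ℕ
  genus = length elements

  -- Indices are shifted by one: ℓ 0 is the ℓ₁ of the literature.
  ℓ : Fin genus → ℕ
  ℓ = lookup elements

open Gapset public

IsLeast : Pred ℕ 0ℓ → Pred ℕ 0ℓ
IsLeast P k = P k × (∀ {j} → P j → k ≤ j)

least : ∀ {P : Pred ℕ 0ℓ} → Decidable P → ∀ b → P b → ∃ (IsLeast P)
least P? zero P0 = 0 , P0 , λ _ → z≤n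
least {P} P? (suc b) Pb with P? 0
... | yes P0 = 0 , P0 , λ _ → z≤n
... | no ¬P0 with least (λ k → P? (suc k)) b Pb
...   | k , Pk , k≤ = suc k , Pk , minimal
  where
  minimal : ∀ {j} → P j → suc k ≤ j
  minimal {zero}  P0 = contradiction P0 ¬P0
  minimal {suc j} Pj = s≤s (k≤ Pj)

IsNongap : Gapset → Pred ℕ 0ℓ
IsNongap G s = 1 ≤ s × s ∉ elements G

IsGapBound : Gapset → Pred ℕ 0ℓ
IsGapBound G s = 1 ≤ s × (∀ t → s + t ∉ elements G)

isNongap? : ∀ G → Decidable (IsNongap G)
isNongap? G s = (1 ≤? s) ×-dec ¬? (s ∈? elements G)

isGapBound? : ∀ G → Decidable (IsGapBound G)
isGapBound? G s = (1 ≤? s) ×-dec map′ to from (All.all? (_<? s) (elements G))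
  where
  to : All (_< s) (elements G) → ∀ t → s + t ∉ elements G
  to all t s+t∈ = <⇒≱ (All.lookup all s+t∈) (m≤m+n s t)

  from : (∀ t → s + t ∉ elements G) → All (_< s) (elements G)
  from s+t∉ = All.tabulate λ {x} x∈ → ≰⇒> λ s≤x →
    s+t∉ (x ∸ s) (subst (_∈ elements G) (sym (m+[n∸m]≡n s≤x)) x∈)

someGapBound : ∀ G → ∃ (IsGapBound G)
someGapBound G = suc M , s≤s z≤n , λ t s+t∈ →
  <⇒≱ (s≤s (m≤m+n M t)) (All.lookup (xs≤max 0 (elements G)) s+t∈)
  where
  M : ℕ
  M = max 0 (elements G)

someNongap : ∀ G → ∃ (IsNongap G)
someNongap G with someGapBound G
... | s , 1≤s , s+t∉ =
  s , 1≤s , subst (_∉ elements G) (+-identityʳ s) (s+t∉ 0)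

leastNongap : ∀ G → ∃ (IsLeast (IsNongap G))
leastNongap G = least (isNongap? G) _ (proj₂ (someNongap G))

leastGapBound : ∀ G → ∃ (IsLeast (IsGapBound G))
leastGapBound G = least (isGapBound? G) _ (proj₂ (someGapBound G))

multiplicity : Gapset → ℕ
multiplicity G = proj₁ (leastNongap G)

multiplicity-least : ∀ G → IsLeast (IsNongap G) (multiplicity G)
multiplicity-least G = proj₂ (leastNongap G)

conductor : Gapset → ℕ
conductor G = proj₁ (leastGapBound G)

conductor-least : ∀ G → IsLeast (IsGapBound G) (conductor G)
conductor-least G = proj₂ (leastGapBound G)

-- The subtraction never truncates, since conductor G ≥ 1.
frobenius : Gapset → ℕ
frobenius G = conductor G ∸ 1

multiplicity-nonZero : ∀ G → NonZero (multiplicity G)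
multiplicity-nonZero G = >-nonZero (proj₁ (proj₁ (multiplicity-least G)))

⌈_/_⌉ : (a b : ℕ) .{{_ : NonZero b}} → ℕ
⌈ a / b ⌉ = (a + (b ∸ 1)) / b

depth : Gapset → ℕ
depth G = ⌈ conductor G / multiplicity G ⌉
  where
  instance
    m≢0 : NonZero (multiplicity G)
    m≢0 = multiplicity-nonZero G

-- F(G) = 2g - 1, written without the subtraction, which would truncate at g = 0.
Symmetric : Gapset → Set
Symmetric G = frobenius G + 1 ≡ 2 * genus G

Consecutive : ∀ {g} → Fin g → Fin g → Set
Consecutive i j = toℕ j ≡ suc (toℕ i)

-- The truncated subtraction below is exact, because ℓ is increasing.
PureSparse : ℕ → Gapset → Set
PureSparse κ G =
  (∀ i j → Consecutive i j → ℓ G j ∸ ℓ G i ≤ κ) ×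
  (∃₂ λ i j → Consecutive i j × ℓ G j ∸ ℓ G i ≡ κ)

{-# OPTIONS --safe #-}

-- Write F for the Frobenius number, m for the multiplicity and κ = 2n.
-- For every 0 ≤ j ≤ F one of j, F - j is a gap, so F + 1 ≤ 2g, and if
-- equality holds then exactly one of the two is a gap.  A pair of consecutive
-- gaps b - a = κ forces κ ≤ m: otherwise b - m would lie strictly between a and
-- b, hence be a nongap, and so would b = (b - m) + m.
-- If q = 4, then F ≥ 3m, and 3m is no gap, so 2g ≥ F + 1 ≥ 3m + 2 ≥ 6n + 2 = 2g.
-- If G is symmetric and x is the gap before F, then F - x ≤ κ is a nongap, so
-- m = κ = 2n and q = ⌈(6n + 2) / 2n⌉ = 4.
module Submission where

open import Defs
open import Data.Fin.Base as Fin using (Fin; zero; suc)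
import Data.Fin.Properties as Fin
open import Data.List.Base using (List; _∷_; _++_; filter; length; lookup; map)
open import Data.List.Membership.Propositional using (_∈_; _∉_)
import Data.List.Membership.DecPropositional as DecMembership
open import Data.List.Membership.Propositional.Properties
  using (∈-++⁺ˡ; ∈-++⁺ʳ; ∈-filter⁺; ∈-lookup; ∈-map⁺)
open import Data.List.Properties using (filter-notAll; length-++; length-map)
open import Data.List.Relation.Unary.All as All using (_∷_)
open import Data.List.Relation.Unary.Any as Any using (index)
open import Data.List.Relation.Unary.Any.Properties using (lookup-index)
open import Data.List.Relation.Unary.Linked using (Linked)
open import Data.List.Relation.Unary.Linked.Properties using (Linked⇒AllPairs)
open import Data.List.Relation.Unary.AllPairs using (AllPairs; _∷_)
open import Data.Nat.Base
open import Data.Nat.DivMod using (_/_; m/n*n≤m; m<n*o⇒m/o<n; m*n/n≡m; /-monoˡ-≤)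
open import Data.Nat.Properties
open import Data.Nat.Tactic.RingSolver using (solve-∀)
open import Data.Product.Base using (∃; _,_; proj₁; proj₂)
open import Data.Sum.Base using (_⊎_; inj₁; inj₂; [_,_]′)
open import Function.Base using (_∘_)
open import Function.Bundles using (_⇔_; mk⇔)
open import Relation.Binary.PropositionalEquality
open import Relation.Nullary.Decidable using (yes; no; ¬?; decidable-stable)
open import Relation.Nullary.Negation using (contradiction)

open DecMembership _≟_ using (_∈?_)

-- Positions in strictly increasing lists.

lookup-mono-< : ∀ {xs} → Linked _<_ xs → ∀ {i j} → i Fin.< j → lookup xs i < lookup xs j
lookup-mono-< xs↗ = go (Linked⇒AllPairs <-trans xs↗)
  where
  go : ∀ {xs} → AllPairs _<_ xs → ∀ {i j} → i Fin.< j → lookup xs i < lookup xs j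
  go {_ ∷ xs} (x< ∷ _)  {zero}  {suc j} _         = All.lookup x< (∈-lookup j)
  go {_ ∷ xs} (_ ∷ xs↗) {suc i} {suc j} (s≤s i<j) = go xs↗ i<j

lookup-cancel-< : ∀ {xs} → Linked _<_ xs → ∀ {i j} → lookup xs i < lookup xs j → i Fin.< j
lookup-cancel-< {xs} xs↗ {i} {j} xᵢ<xⱼ = ≰⇒> λ j≤i → <⇒≱ xᵢ<xⱼ (mono j≤i)
  where
  mono : j Fin.≤ i → lookup xs j ≤ lookup xs i
  mono j≤i with m≤n⇒m<n∨m≡n j≤i
  ... | inj₁ j<i = <⇒≤ (lookup-mono-< xs↗ j<i)
  ... | inj₂ j≡i = ≤-reflexive (cong (lookup xs) (Fin.toℕ-injective j≡i))

-- The position of such a `z` would lie strictly between `i` and its successor `j`.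
consecutive-between : ∀ {xs} → Linked _<_ xs → ∀ {i j} → Consecutive i j →
  ∀ {z} → lookup xs i < z → z < lookup xs j → z ∉ xs
consecutive-between {xs} xs↗ {i} {j} j≡1+i xᵢ<z z<xⱼ z∈xs =
  <⇒≱ i<k (≤-pred (≤-trans k<j (≤-reflexive j≡1+i)))
  where
  z≡xₖ = lookup-index z∈xs
  i<k  = lookup-cancel-< xs↗ {i} {index z∈xs} (subst (lookup xs i <_) z≡xₖ xᵢ<z)
  k<j  = lookup-cancel-< xs↗ {index z∈xs} {j} (subst (_< lookup xs j) z≡xₖ z<xⱼ)

predecessor : ∀ {g} {i k : Fin g} → i Fin.< k → ∃ λ p → Consecutive p k
predecessor {k = suc p} _ = Fin.inject₁ p , cong suc (sym (Fin.toℕ-inject₁ p))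

-- Pigeonhole: sending each `j < N` to a position where it occurs is injective, since looking up
-- that position recovers `j`. Repetitions in `xs` do no harm.
covers⇒≤length : ∀ {N} {xs : List ℕ} → (∀ {j} → j < N → j ∈ xs) → N ≤ length xs
covers⇒≤length {N} {xs} cover = Fin.injective⇒≤ {f = f} λ {i} {j} fi≡fj →
  Fin.toℕ-injective (trans (lookup-index (cover (Fin.toℕ<n i)))
    (trans (cong (lookup xs) fi≡fj) (sym (lookup-index (cover (Fin.toℕ<n j))))))
  where
  f : Fin N → Fin (length xs)
  f i = index (cover (Fin.toℕ<n i))

length-++-reflect : ∀ F (xs ys : List ℕ) → length (xs ++ map (F ∸_) ys) ≡ length xs + length ys
length-++-reflect F xs ys =
  trans (length-++ xs) (cong (length xs +_) (length-map (F ∸_) ys))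

∈-reflect : ∀ {F ys j} → j ≤ F → F ∸ j ∈ ys → j ∈ map (F ∸_) ys
∈-reflect {F} j≤F F∸j∈ = subst (_∈ _) (m∸[m∸n]≡n j≤F) (∈-map⁺ (F ∸_) F∸j∈)

-- Ceiling division.

⌈/⌉≡1+k⇒k*b<a : ∀ {a b k} .{{_ : NonZero b}} → ⌈ a / b ⌉ ≡ suc k → k * b < a
-- Adding `b-1` to both sides turns `k * b < a` into `suc k * b ≤ a + b-1`, whose right side is the
-- numerator in the ceiling.
⌈/⌉≡1+k⇒k*b<a {a} {b@(suc b-1)} {k} q≡1+k = +-cancelˡ-≤ b-1 (suc (k * b)) a (begin
  b-1 + suc (k * b)       ≡⟨ +-suc b-1 (k * b) ⟩
  suc k * b               ≡⟨ cong (_* b) q≡1+k ⟨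
  (a + b-1) / b * b       ≤⟨ m/n*n≤m (a + b-1) b ⟩
  a + b-1                 ≡⟨ +-comm a b-1 ⟩
  b-1 + a                 ∎)
  where open ≤-Reasoning

k*b<a≤[1+k]*b⇒⌈/⌉≡1+k : ∀ {a b k} .{{_ : NonZero b}} →
  k * b < a → a ≤ suc k * b → ⌈ a / b ⌉ ≡ suc k
k*b<a≤[1+k]*b⇒⌈/⌉≡1+k {a} {b@(suc b-1)} {k} lower upper = ≤-antisym
  (≤-pred (m<n*o⇒m/o<n {a + b-1} {suc (suc k)} {b} (begin-strict
    a + b-1               <⟨ +-mono-≤-< upper (n<1+n b-1) ⟩
    suc k * b + b         ≡⟨ +-comm (suc k * b) b ⟩
    suc (suc k) * b       ∎)))
  (begin
    suc k                 ≡⟨ m*n/n≡m (suc k) b ⟨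
    suc k * b / b         ≡⟨ cong (_/ b) (+-suc b-1 (k * b)) ⟨
    (b-1 + suc (k * b)) / b ≤⟨ /-monoˡ-≤ b (+-monoʳ-≤ b-1 lower) ⟩
    (b-1 + a) / b         ≡⟨ cong (_/ b) (+-comm b-1 a) ⟩
    (a + b-1) / b         ∎)
  where open ≤-Reasoning

-- Gaps, nongaps and the reflection of `0, …, F`.

module _ (G : Gapset) where

  private
    E = elements G
    F = frobenius G
    m = multiplicity G
    c = conductor G

  1+frobenius≡conductor : suc F ≡ c
  1+frobenius≡conductor = m+[n∸m]≡n (proj₁ (proj₁ (conductor-least G)))

  gap⇒≤frobenius : ∀ {x} → x ∈ E → x ≤ F
  gap⇒≤frobenius {x} x∈E = ≤-pred (≤-trans x<c (≤-reflexive (sym 1+frobenius≡conductor)))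
    where
    x<c : x < c
    x<c = ≰⇒> λ c≤x → proj₂ (proj₁ (conductor-least G)) (x ∸ c)
      (subst (_∈ E) (sym (m+[n∸m]≡n c≤x)) x∈E)

  gap⇒positive : ∀ {x} → x ∈ E → 1 ≤ x
  gap⇒positive = All.lookup (positive G)

  -- Otherwise `F` would be a gap bound smaller than the conductor. The given gap supplies `1 ≤ F`;
  -- the empty gapset has `F = 0`, which is no gap.
  frobenius-gap : ∀ {x} → x ∈ E → F ∈ E
  frobenius-gap x∈E = decidable-stable (F ∈? E) λ F∉E →
    <⇒≱ (≤-reflexive 1+frobenius≡conductor) (proj₂ (conductor-least G) (1≤F , F+t∉E F∉E))
    where
    1≤F : 1 ≤ F
    1≤F = ≤-trans (gap⇒positive x∈E) (gap⇒≤frobenius x∈E)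
    F+t∉E : F ∉ E → ∀ t → F + t ∉ E
    F+t∉E F∉E zero    = subst (_∉ E) (sym (+-identityʳ F)) F∉E
    F+t∉E F∉E (suc t) = <⇒≱ (m<m+n F z<s) ∘ gap⇒≤frobenius

  multiplicity≤nongap : ∀ {s} → 1 ≤ s → s ∉ E → m ≤ s
  multiplicity≤nongap 1≤s s∉E = proj₂ (multiplicity-least G) (1≤s , s∉E)

  1≤multiplicity : 1 ≤ m
  1≤multiplicity = proj₁ (proj₁ (multiplicity-least G))

  multiplicity∉ : m ∉ E
  multiplicity∉ = proj₂ (proj₁ (multiplicity-least G))

  -- Nongaps are closed under addition, by the contrapositive of `splits`. The case `k = 1` stands
  -- apart because `splits` needs both summands positive.
  multiple∉ : ∀ k → k * m ∉ E
  multiple∉ zero    0∈E = contradiction (gap⇒positive 0∈E) λ ()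
  multiple∉ (suc zero) = subst (_∉ E) (sym (*-identityˡ m)) multiplicity∉
  multiple∉ (suc k@(suc _)) =
    [ multiplicity∉ , multiple∉ k ]′ ∘
    splits G 1≤multiplicity (≤-trans 1≤multiplicity (m≤m+n m _))

  -- `splits` applies to `F = j + (F ∸ j)` when both summands are positive; at the ends `j = 0` and
  -- `j = F` one of the two is `F` itself.
  gap-or-reflected-gap : F ∈ E → ∀ {j} → j ≤ F → j ∈ E ⊎ F ∸ j ∈ E
  gap-or-reflected-gap F∈E {zero}      _   = inj₂ F∈E
  gap-or-reflected-gap F∈E {j@(suc _)} j≤F with m≤n⇒m<n∨m≡n j≤F
  ... | inj₁ j<F  = splits G (s≤s z≤n) (m<n⇒0<n∸m j<F)
    (subst (_∈ E) (sym (m+[n∸m]≡n j≤F)) F∈E)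
  ... | inj₂ j≡F = inj₁ (subst (_∈ E) (sym j≡F) F∈E)

  1+frobenius≤2*genus : F ∈ E → suc F ≤ 2 * genus G
  1+frobenius≤2*genus F∈E = begin
    suc F                           ≤⟨ covers⇒≤length cover ⟩
    length (E ++ map (F ∸_) E)      ≡⟨ length-++-reflect F E E ⟩
    genus G + genus G               ≡⟨ cong (genus G +_) (+-identityʳ (genus G)) ⟨
    2 * genus G                     ∎
    where
    open ≤-Reasoning
    cover : ∀ {j} → j < suc F → j ∈ E ++ map (F ∸_) E
    cover (s≤s j≤F) =
      [ ∈-++⁺ˡ , ∈-++⁺ʳ E ∘ ∈-reflect j≤F ]′ (gap-or-reflected-gap F∈E j≤F)

  -- If both x and F - x were gaps, then x could be dropped from the first half
  -- of the list E ++ (F - E), which would still cover 0, …, F.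
  symmetric⇒reflected-nongap : Symmetric G → F ∈ E → ∀ {x} → x ∈ E → F ∸ x ∉ E
  symmetric⇒reflected-nongap sym-G F∈E {x} x∈E F∸x∈E = <-irrefl sym-G (begin-strict
    F + 1                              ≡⟨ +-comm F 1 ⟩
    suc F                              ≤⟨ covers⇒≤length cover ⟩
    length (E∖x ++ map (F ∸_) E)       ≡⟨ length-++-reflect F E∖x E ⟩
    length E∖x + genus G
      <⟨ +-monoˡ-< (genus G) (filter-notAll _ E (Any.map (λ x≡y y≢x → y≢x (sym x≡y)) x∈E)) ⟩
    genus G + genus G                  ≡⟨ cong (genus G +_) (+-identityʳ (genus G)) ⟨
    2 * genus G                        ∎)
    where
    open ≤-Reasoning
    E∖x : List ℕ
    E∖x = filter (λ y → ¬? (y ≟ x)) E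
    cover : ∀ {j} → j < suc F → j ∈ E∖x ++ map (F ∸_) E
    cover {j} (s≤s j≤F) with gap-or-reflected-gap F∈E j≤F
    ... | inj₂ F∸j∈E = ∈-++⁺ʳ E∖x (∈-reflect j≤F F∸j∈E)
    ... | inj₁ j∈E with j ≟ x
    -- The dropped `x` is still covered, as the reflection of the gap `F ∸ x`.
    ...   | yes refl = ∈-++⁺ʳ E∖x (∈-reflect j≤F F∸x∈E)
    ...   | no j≢x   = ∈-++⁺ˡ (∈-filter⁺ _ j∈E j≢x)

  -- Bounds on the multiplicity of a pure sparse gapset.

  module _ {κ : ℕ} (sparse : PureSparse κ G) where

    private
      i = proj₁ (proj₂ sparse)
      j = proj₁ (proj₂ (proj₂ sparse))
      i~j = proj₁ (proj₂ (proj₂ (proj₂ sparse)))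
      ℓj∸ℓi≡κ = proj₂ (proj₂ (proj₂ (proj₂ sparse)))

      ℓi<ℓj : ℓ G i < ℓ G j
      ℓi<ℓj = lookup-mono-< (increasing G) (≤-reflexive (sym i~j))

    pureSparse⇒frobenius-gap : F ∈ E
    pureSparse⇒frobenius-gap = frobenius-gap (∈-lookup i)

    pureSparse⇒κ≤multiplicity : κ ≤ m
    pureSparse⇒κ≤multiplicity = ≮⇒≥ λ m<κ →
      let ℓi+m<ℓj : ℓ G i + m < ℓ G j
          ℓi+m<ℓj = subst (ℓ G i + m <_)
            (trans (cong (ℓ G i +_) (sym ℓj∸ℓi≡κ)) (m+[n∸m]≡n (<⇒≤ ℓi<ℓj)))
            (+-monoʳ-< (ℓ G i) m<κ)
          ℓi<ℓj∸m : ℓ G i < ℓ G j ∸ m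
          ℓi<ℓj∸m = m+n≤o⇒m≤o∸n (suc (ℓ G i)) ℓi+m<ℓj
          m≤ℓj : m ≤ ℓ G j
          m≤ℓj = ≤-trans (m≤n+m m (ℓ G i)) (<⇒≤ ℓi+m<ℓj)
          ℓj∸m<ℓj : ℓ G j ∸ m < ℓ G j
          ℓj∸m<ℓj = ∸-monoʳ-< 1≤multiplicity m≤ℓj
      in [ consecutive-between (increasing G) i~j ℓi<ℓj∸m ℓj∸m<ℓj , multiplicity∉ ]′
           (splits G (≤-trans (s≤s z≤n) ℓi<ℓj∸m) 1≤multiplicity
             (subst (_∈ E) (sym (m∸n+n≡m m≤ℓj)) (∈-lookup j)))

    symmetric⇒multiplicity≤κ : Symmetric G → m ≤ κ
    symmetric⇒multiplicity≤κ sym-G = ≤-trans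
      (multiplicity≤nongap (m<n⇒0<n∸m ℓp<F) (symmetric⇒reflected-nongap sym-G F∈E (∈-lookup p)))
      (subst (λ z → z ∸ ℓ G p ≤ κ) (sym F≡ℓk) (proj₁ sparse p k p~k))
      where
      F∈E = pureSparse⇒frobenius-gap
      k = index F∈E
      F≡ℓk : F ≡ ℓ G k
      F≡ℓk = lookup-index F∈E
      -- The pair with difference `κ` shows that `F` is not the smallest gap, so a gap precedes it.
      ℓi<ℓk : ℓ G i < ℓ G k
      ℓi<ℓk = <-≤-trans ℓi<ℓj (subst (ℓ G j ≤_) F≡ℓk (gap⇒≤frobenius (∈-lookup j)))
      pred-k : ∃ λ p → Consecutive p k
      pred-k = predecessor (lookup-cancel-< (increasing G) ℓi<ℓk)
      p = proj₁ pred-k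
      p~k = proj₂ pred-k
      ℓp<F : ℓ G p < F
      ℓp<F = subst (ℓ G p <_) (sym F≡ℓk)
        (lookup-mono-< (increasing G) (≤-reflexive (sym p~k)))

mainTheorem6 : (n : ℕ) → 1 ≤ n → (G : Gapset) → genus G ≡ 3 * n + 1 →
    PureSparse (2 * n) G → Symmetric G ⇔ depth G ≡ 4
mainTheorem6 n 1≤n G g≡3n+1 sparse = mk⇔ symmetric⇒depth≡4 depth≡4⇒symmetric
  where
  open ≤-Reasoning
  F = frobenius G
  m = multiplicity G
  c = conductor G
  F∈E = pureSparse⇒frobenius-gap G sparse
  2n≤m = pureSparse⇒κ≤multiplicity G sparse

  instance
    m≢0 : NonZero m
    m≢0 = multiplicity-nonZero G

  2g≡3*2n+2 : 2 * genus G ≡ 3 * (2 * n) + 2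
  2g≡3*2n+2 = trans (cong (2 *_) g≡3n+1) (identity n)
    where
    identity : ∀ n → 2 * (3 * n + 1) ≡ 3 * (2 * n) + 2
    identity = solve-∀

  symmetric⇒depth≡4 : Symmetric G → depth G ≡ 4
  symmetric⇒depth≡4 sym-G = k*b<a≤[1+k]*b⇒⌈/⌉≡1+k {c} {m} {3}
    (begin-strict
      3 * m             ≡⟨ cong (3 *_) m≡2n ⟩
      3 * (2 * n)       <⟨ m<m+n (3 * (2 * n)) z<s ⟩
      3 * (2 * n) + 2   ≡⟨ c≡3*2n+2 ⟨
      c                 ∎)
    (begin
      c                 ≡⟨ c≡3*2n+2 ⟩
      -- Here `1 ≤ n` enters: the remainder 2 fits into one more multiple of `2 * n`.
      3 * (2 * n) + 2   ≤⟨ +-monoʳ-≤ (3 * (2 * n)) (*-monoʳ-≤ 2 1≤n) ⟩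
      3 * (2 * n) + 2 * n ≡⟨ +-comm (3 * (2 * n)) (2 * n) ⟩
      4 * (2 * n)       ≡⟨ cong (4 *_) m≡2n ⟨
      4 * m             ∎)
    where
    m≡2n : m ≡ 2 * n
    m≡2n = ≤-antisym (symmetric⇒multiplicity≤κ G sparse sym-G) 2n≤m
    c≡3*2n+2 : c ≡ 3 * (2 * n) + 2
    c≡3*2n+2 = begin-equality
      c                 ≡⟨ 1+frobenius≡conductor G ⟨
      suc F             ≡⟨ +-comm F 1 ⟨
      F + 1             ≡⟨ sym-G ⟩
      2 * genus G       ≡⟨ 2g≡3*2n+2 ⟩
      3 * (2 * n) + 2   ∎

  depth≡4⇒symmetric : depth G ≡ 4 → Symmetric G
  depth≡4⇒symmetric q≡4 = trans (+-comm F 1) (≤-antisym (1+frobenius≤2*genus G F∈E) (begin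
    2 * genus G         ≡⟨ 2g≡3*2n+2 ⟩
    3 * (2 * n) + 2     ≤⟨ +-monoˡ-≤ 2 (*-monoʳ-≤ 3 2n≤m) ⟩
    3 * m + 2           ≡⟨ +-comm (3 * m) 2 ⟩
    -- Depth 4 alone gives `3 * m ≤ F`. The inequality is strict because `F` is a gap and `3 * m` is
    -- not, and this extra unit makes the bound meet `2 * genus G`.
    suc (suc (3 * m))   ≤⟨ s≤s (≤∧≢⇒< 3m≤F 3m≢F) ⟩
    suc F               ∎))
    where
    3m≤F : 3 * m ≤ F
    3m≤F = ≤-pred (≤-trans (⌈/⌉≡1+k⇒k*b<a q≡4) (≤-reflexive (sym (1+frobenius≡conductor G))))
    3m≢F : 3 * m ≢ F
    3m≢F 3m≡F = multiple∉ G 3 (subst (_∈ elements G) (sym 3m≡F) F∈E)
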